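{- There exists an absolute constant $c>0$ such that the following holds. If $A\subseteq[N]$ is a set and $B$ is a subset of $[1,c|A|^2]$ consisting of pairwise coprime integers, none of which divides a member of $\Sigma^*(A)$, then $$|A|\sum_{b\in B}\frac{\log b}{b}\ll \log N,$$ where the implied constant is absolute.
   Context: $[N]=\{1,\dots,N\}$. For a set $A$ of integers, $\Sigma^*(A)$ denotes the set of sums $\sum_{a\in A'}a$ over nonempty subsets $A'\subseteq A$. $X\ll Y$ means $|X|\le CY$ for an absolute constant $C$. -}

module Defs where

open import Data.Nat using (ℕ; zero; suc; _+_; _*_; _^_; _≤_)
open import Data.List using (List; []; _∷_)
open import Data.Nat.ListAction using (sum; product)
open import Data.List.Relation.Binary.Sublist.Propositional using (_⊆_)
open import Data.Product using (∃; _×_)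
open import Relation.Binary.PropositionalEquality using (_≡_; _≢_)

-- s ∈ Σ*(A): s is the sum of a nonempty sub-collection of A.
-- (A will be a duplicate-free list, so sublists = subsets.)
SubsetSum : List ℕ → ℕ → Set
SubsetSum A s = ∃ λ (A' : List ℕ) → (A' ⊆ A) × (A' ≢ []) × (sum A' ≡ s)

-- weightPow k B = ∏_{b ∈ B} b ^ (k * P / b), where P = product B,
-- computed without division: P / b is the product of the other elements.
-- For B of positive integers, log (weightPow k B) = P · k · Σ_{b∈B} (log b)/b.
weightPow : ℕ → List ℕ → ℕ
weightPow k bs = go 1 bs
  where
  go : ℕ → List ℕ → ℕ
  go pre [] = 1
  go pre (b ∷ rest) = b ^ (k * (pre * product rest)) * go (pre * b) rest

module Submission where

-- Fix b ∈ B. A zero-sum-free list of m elements mod b in which no residue occurs more than h times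
-- satisfies m² ≪ h b. To see this, build up the set of subset sums of a part of the list, one element
-- at a time. If x ranges over generators of ℤ/b and |(X + x) ∖ X| ≤ ℓ for all of them, then the
-- autocorrelation y ↦ |X ∩ (X + y)| is ℓ-Lipschitz along generators, and descends from |X| to below
-- |X| / 2; each level passed on the way contains a translate of all the generators, so ℓ ≫ m / h.
-- Hence the subset sums of a small part of the list fill over half of ℤ/b, and two disjoint such
-- parts produce a zero sum. (Non-generating lists live in a proper subgroup, where one recurses.)
--
-- With h of order |A|² / b, at most half of A lies in residue classes with at most h elements of A.
-- So the number E b of pairs a ≠ a′ in A with b ∣ a − a′ is ≫ |A|³ / b. As B is pairwise coprime,
-- ∏ b ^ E b divides the product of the differences a − a′, which is at most N ^ |A|².

open import Defs
open import Data.Bool using (Bool; true; false; not; _∧_; _∨_)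
open import Data.List using (List; []; _∷_; _++_; length; map; filter; foldr)
open import Data.List.Membership.Propositional using (_∈_; find; lose)
open import Data.List.Membership.Propositional.Properties using (∈-∃++; ∈-filter⁻)
open import Data.List.Properties using (length-++; map-++; ++-assoc; length-map)
open import Data.List.Relation.Binary.Permutation.Propositional as ↭ hiding (trans)
import Data.List.Relation.Binary.Permutation.Propositional.Properties as Perm
open Perm using (map⁺; ↭-length; ++⁺ˡ; ++⁺; shift; shifts)
open import Data.List.Relation.Binary.Sublist.Propositional
  using (_⊆_; []; _∷_; _∷ʳ_; ⊆-refl; ⊆-trans)
import Data.List.Relation.Binary.Sublist.Propositional.Properties as Sub
open import Data.List.Relation.Unary.All using (All; []; _∷_)
open import Data.List.Relation.Unary.AllPairs using (AllPairs; []; _∷_)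
open import Data.List.Relation.Unary.Any using (here; there; any?)
open import Data.List.Relation.Unary.Unique.Propositional using (Unique)
open import Data.Nat
open import Data.Nat.Coprimality using (Coprime; coprime-divisor)
open import Data.Nat.DivMod
open import Data.Nat.Divisibility
open import Data.Nat.GCD
open import Data.Nat.Induction using (<-rec)
open import Data.Nat.ListAction using (sum; product)
open import Data.Nat.ListAction.Properties using (sum-++; sum-↭)
open import Data.Nat.Properties
open import Data.Nat.Tactic.RingSolver using (solve-∀)
open import Data.Product using (∃; _×_; _,_; proj₁; proj₂)
open import Data.Sum using (_⊎_; inj₁; inj₂)
open import Function using (_∘_)
open import Relation.Binary.PropositionalEquality
open import Relation.Nullary using (¬_; Dec; yes; no; does; contradiction)
open import Relation.Nullary.Decidable using (dec-true; dec-false; _×-dec_)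

-- Sums over an interval and periodic functions

∑< : ℕ → (ℕ → ℕ) → ℕ
∑< zero    f = 0
∑< (suc n) f = ∑< n f + f n

∑-cong : ∀ n {f g : ℕ → ℕ} → (∀ i → f i ≡ g i) → ∑< n f ≡ ∑< n g
∑-cong zero    f≗g = refl
∑-cong (suc n) f≗g = cong₂ _+_ (∑-cong n f≗g) (f≗g n)

∑-mono : ∀ n {f g : ℕ → ℕ} → (∀ i → f i ≤ g i) → ∑< n f ≤ ∑< n g
∑-mono zero    f≤g = z≤n
∑-mono (suc n) f≤g = +-mono-≤ (∑-mono n f≤g) (f≤g n)

∑-+ : ∀ n (f g : ℕ → ℕ) → ∑< n (λ i → f i + g i) ≡ ∑< n f + ∑< n g
∑-+ zero    f g = refl
∑-+ (suc n) f g = trans (cong (_+ (f n + g n)) (∑-+ n f g))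
  (interchange (∑< n f) (∑< n g) (f n) (g n))
  where
  interchange : ∀ a b c d → a + b + (c + d) ≡ a + c + (b + d)
  interchange = solve-∀

∑-*ˡ : ∀ n c (f : ℕ → ℕ) → ∑< n (λ i → c * f i) ≡ c * ∑< n f
∑-*ˡ zero    c f = sym (*-zeroʳ c)
∑-*ˡ (suc n) c f = trans (cong (_+ c * f n) (∑-*ˡ n c f)) (sym (*-distribˡ-+ c (∑< n f) (f n)))

∑-const : ∀ n c → ∑< n (λ _ → c) ≡ n * c
∑-const zero    c = refl
∑-const (suc n) c = trans (cong (_+ c) (∑-const n c)) (+-comm (n * c) c)

∑-swap : ∀ m n (f : ℕ → ℕ → ℕ) →
  ∑< m (λ i → ∑< n (f i)) ≡ ∑< n (λ j → ∑< m (λ i → f i j))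
∑-swap zero    n f = sym (trans (∑-const n 0) (*-zeroʳ n))
∑-swap (suc m) n f = trans (cong (_+ ∑< n (f m)) (∑-swap m n f))
  (sym (∑-+ n (λ j → ∑< m (λ i → f i j)) (f m)))

∑-suc : ∀ n (f : ℕ → ℕ) → ∑< (suc n) f ≡ f 0 + ∑< n (f ∘ suc)
∑-suc zero    f = +-comm 0 (f 0)
∑-suc (suc n) f = trans (cong (_+ f (suc n)) (∑-suc n f)) (+-assoc (f 0) _ _)

∑-reverse : ∀ n (f : ℕ → ℕ) → ∑< n (λ i → f (n ∸ suc i)) ≡ ∑< n f
∑-reverse zero    f = refl
∑-reverse (suc n) f = trans (∑-suc n (λ i → f (n ∸ i)))
  (trans (cong (f n +_) (∑-reverse n f)) (+-comm (f n) _))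

ι : Bool → ℕ
ι true  = 1
ι false = 0

pigeonhole : ∀ n (p q : ℕ → Bool) → n < ∑< n (ι ∘ p) + ∑< n (ι ∘ q) →
  ∃ λ i → i < n × p i ≡ true × q i ≡ true
pigeonhole (suc n) p q lt with p n in pn | q n in qn
... | true  | true  = n , ≤-refl , pn , qn
... | true  | false = let i , i<n , r = pigeonhole n p q (s≤s⁻¹ (subst (suc n <_) (eq (∑< n (ι ∘ p)) (∑< n (ι ∘ q))) lt))
                      in i , m<n⇒m<1+n i<n , r
  where
  eq : ∀ a c → a + 1 + (c + 0) ≡ suc (a + c)
  eq = solve-∀
... | false | true  = let i , i<n , r = pigeonhole n p q (s≤s⁻¹ (subst (suc n <_) (eq (∑< n (ι ∘ p)) (∑< n (ι ∘ q))) lt))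
                      in i , m<n⇒m<1+n i<n , r
  where
  eq : ∀ a c → a + 0 + (c + 1) ≡ suc (a + c)
  eq = solve-∀
... | false | false = let i , i<n , r = pigeonhole n p q (<-trans (n<1+n n) (subst (suc n <_) (eq (∑< n (ι ∘ p)) (∑< n (ι ∘ q))) lt))
                      in i , m<n⇒m<1+n i<n , r
  where
  eq : ∀ a c → a + 0 + (c + 0) ≡ a + c
  eq = solve-∀

module _ (b : ℕ) where

  -- Functions and sets on ℤ/b are represented by `b`-periodic functions on ℕ, so that translation
  -- is plain addition.
  Periodic : {A : Set} → (ℕ → A) → Set
  Periodic f = ∀ i → f (i + b) ≡ f i

module _ {b : ℕ} where

  periodic-* : {A : Set} {f : ℕ → A} → Periodic b f → ∀ k i → f (i + k * b) ≡ f i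
  periodic-* {f = f} per zero    i = cong f (+-identityʳ i)
  periodic-* {f = f} per (suc k) i = trans (cong f (sym (+-assoc i b (k * b))))
    (trans (periodic-* per k (i + b)) (per i))

  periodic-% : {A : Set} {f : ℕ → A} .{{_ : NonZero b}} → Periodic b f → ∀ i → f (i % b) ≡ f i
  periodic-% {f = f} per i = trans (sym (periodic-* per (i / b) (i % b)))
    (cong f (sym (m≡m%n+[m/n]*n i b)))

  periodic-shift : {A : Set} {f : ℕ → A} → Periodic b f → ∀ x → Periodic b (λ i → f (i + x))
  periodic-shift {f = f} per x i = trans (cong f (eq i b x)) (per (i + x))
    where
    eq : ∀ i b x → i + b + x ≡ i + x + b
    eq = solve-∀

  ∑-shift : {f : ℕ → ℕ} → Periodic b f → ∀ x → ∑< b (λ i → f (i + x)) ≡ ∑< b f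
  ∑-shift {f} per zero    = ∑-cong b (λ i → cong f (+-identityʳ i))
  -- One further shift drops `h 0` and appends `h b`, which agree by periodicity.
  ∑-shift {f} per (suc x) = trans (∑-cong b (λ i → cong f (+-suc i x)))
    (trans (+-cancelˡ-≡ (h 0) _ _
      (trans (sym (∑-suc b h)) (trans (+-comm (∑< b h) (h b))
        (cong (_+ ∑< b h) (periodic-shift per x 0)))))
      (∑-shift per x))
    where
    h : ℕ → ℕ
    h i = f (i + x)

-- Autocorrelation of a set of residues

module Autocorrelation {b : ℕ} (B : ℕ → Bool) (per : Periodic b B) where

  size : ℕ
  size = ∑< b (ι ∘ B)

  corr : ℕ → ℕ
  corr y = ∑< b (λ i → ι (B i ∧ B (i + y)))

  -- With X the set whose indicator is `B`, this is |(X - x) ∖ X|: the number of residues X acquires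
  -- when joined with its translate by -x.
  gain : ℕ → ℕ
  gain x = ∑< b (λ i → ι (not (B i) ∧ B (i + x)))

  loss : ℕ → ℕ
  loss x = ∑< b (λ i → ι (B i ∧ not (B (i + x))))

  periodic-+ : ∀ i y → B (i + (y + b)) ≡ B (i + y)
  periodic-+ i y = trans (cong B (sym (+-assoc i y b))) (per (i + y))

  corr-periodic : Periodic b corr
  corr-periodic y = ∑-cong b (λ i → cong (λ t → ι (B i ∧ t)) (periodic-+ i y))

  corr-0 : corr 0 ≡ size
  corr-0 = ∑-cong b (λ i → trans (cong (λ j → ι (B i ∧ B j)) (+-identityʳ i)) (idem (B i)))
    where
    idem : ∀ p → ι (p ∧ p) ≡ ι p
    idem true  = refl
    idem false = refl

  -- X and X - x have the same size, hence so do their two differences.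
  loss≡gain : ∀ x → loss x ≡ gain x
  loss≡gain x = +-cancelˡ-≡ size _ _ (begin
    size + loss x                     ≡⟨ cong (_+ loss x) (sym (∑-shift (λ i → cong ι (per i)) x)) ⟩
    ∑< b (λ i → ι (B (i + x))) + loss x ≡⟨ sym (∑-+ b _ _) ⟩
    ∑< b (λ i → ι (B (i + x)) + ι (B i ∧ not (B (i + x))))
                                      ≡⟨ ∑-cong b (λ i → pointwise (B i) (B (i + x))) ⟩
    ∑< b (λ i → ι (B i) + ι (not (B i) ∧ B (i + x))) ≡⟨ ∑-+ b _ _ ⟩
    size + gain x                     ∎)
    where
    open ≡-Reasoning
    pointwise : ∀ p q → ι q + ι (p ∧ not q) ≡ ι p + ι (not p ∧ q)
    pointwise true  true  = refl
    pointwise true  false = refl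
    pointwise false true  = refl
    pointwise false false = refl

  private
    sum-periodic-∧ : ∀ (op : Bool → Bool → Bool) x y →
      ∑< b (λ i → ι (op (B (i + y)) (B (i + y + x)))) ≡ ∑< b (λ i → ι (op (B i) (B (i + x))))
    sum-periodic-∧ op x y = ∑-shift
      (λ i → cong₂ (λ p q → ι (op p q)) (per i) (periodic-shift per x i)) y

  -- If i and i + y + x lie in X but i + y does not, then i + y is counted by `gain x`. Together
  -- with `corr-≤-+` this is the Lipschitz property of `corr`.
  corr-+-≤ : ∀ y x → corr (y + x) ≤ corr y + gain x
  corr-+-≤ y x = begin
    corr (y + x)
      ≤⟨ ∑-mono b (λ i → subst (λ j → ι (B i ∧ B j) ≤ ι (B i ∧ B (i + y)) + ι (not (B (i + y)) ∧ B (i + y + x)))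
           (+-assoc i y x) (pointwise (B i) (B (i + y)) (B (i + y + x)))) ⟩
    ∑< b (λ i → ι (B i ∧ B (i + y)) + ι (not (B (i + y)) ∧ B (i + y + x))) ≡⟨ ∑-+ b _ _ ⟩
    corr y + ∑< b (λ i → ι (not (B (i + y)) ∧ B (i + y + x)))
      ≡⟨ cong (corr y +_) (sum-periodic-∧ (λ p q → not p ∧ q) x y) ⟩
    corr y + gain x ∎
    where
    open ≤-Reasoning
    pointwise : ∀ p q r → ι (p ∧ r) ≤ ι (p ∧ q) + ι (not q ∧ r)
    pointwise false q     r     = z≤n
    pointwise true  q     false = z≤n
    pointwise true  true  true  = s≤s z≤n
    pointwise true  false true  = s≤s z≤n

  corr-≤-+ : ∀ y x → corr y ≤ corr (y + x) + gain x
  corr-≤-+ y x = begin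
    corr y
      ≤⟨ ∑-mono b (λ i → subst (λ j → ι (B i ∧ B (i + y)) ≤ ι (B i ∧ B j) + ι (B (i + y) ∧ not (B (i + y + x))))
           (+-assoc i y x) (pointwise (B i) (B (i + y)) (B (i + y + x)))) ⟩
    ∑< b (λ i → ι (B i ∧ B (i + (y + x))) + ι (B (i + y) ∧ not (B (i + y + x)))) ≡⟨ ∑-+ b _ _ ⟩
    corr (y + x) + ∑< b (λ i → ι (B (i + y) ∧ not (B (i + y + x))))
      ≡⟨ cong (corr (y + x) +_)
           (trans (sum-periodic-∧ (λ p q → p ∧ not q) x y) (loss≡gain x)) ⟩
    corr (y + x) + gain x ∎
    where
    open ≤-Reasoning
    pointwise : ∀ p q r → ι (p ∧ q) ≤ ι (p ∧ r) + ι (q ∧ not r)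
    pointwise false q     r     = z≤n
    pointwise true  false r     = z≤n
    pointwise true  true  true  = s≤s z≤n
    pointwise true  true  false = s≤s z≤n

  -- Both sides count ordered pairs in X: for fixed i in X, the point i + y runs over a full period.
  ∑-corr : ∑< b corr ≡ size * size
  ∑-corr = begin
    ∑< b corr                                        ≡⟨ ∑-swap b b (λ y i → ι (B i ∧ B (i + y))) ⟩
    ∑< b (λ i → ∑< b (λ y → ι (B i ∧ B (i + y))))    ≡⟨ ∑-cong b row ⟩
    ∑< b (λ i → size * ι (B i))                      ≡⟨ ∑-*ˡ b size _ ⟩
    size * size                                      ∎
    where
    open ≡-Reasoning
    row : ∀ i → ∑< b (λ y → ι (B i ∧ B (i + y))) ≡ size * ι (B i)
    row i with B i
    ... | false = trans (∑-const b 0) (trans (*-zeroʳ b) (sym (*-zeroʳ size)))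
    ... | true  = trans (∑-cong b (λ y → cong (ι ∘ B) (+-comm i y)))
      (trans (∑-shift (λ j → cong ι (per j)) i) (sym (*-identityʳ size)))

-- Translates of a set that generate large gains

∑-δ-≥ : ∀ n {r} (φ : ℕ → ℕ) → n ≤ r → ∑< n (λ z → ι (does (r ≟ z)) * φ z) ≡ 0
∑-δ-≥ zero        φ n≤r = refl
∑-δ-≥ (suc n) {r} φ n<r rewrite dec-false (r ≟ n) (>⇒≢ n<r) =
  trans (+-identityʳ _) (∑-δ-≥ n φ (<⇒≤ n<r))

∑-δ : ∀ n {r} (φ : ℕ → ℕ) → r < n → ∑< n (λ z → ι (does (r ≟ z)) * φ z) ≡ φ r
∑-δ (suc n) {r} φ r<1+n with r ≟ n
... | yes refl rewrite dec-true (n ≟ n) refl =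
  trans (cong (_+ (φ n + 0)) (∑-δ-≥ n φ ≤-refl)) (+-identityʳ (φ n))
... | no r≢n rewrite dec-false (r ≟ n) r≢n =
  trans (+-identityʳ _) (∑-δ n φ (≤∧≢⇒< (s≤s⁻¹ r<1+n) r≢n))

mult : ∀ b .{{_ : NonZero b}} → List ℕ → ℕ → ℕ
mult b L z = sum (map (λ a → ι (does (a % b ≟ z))) L)

∑-mult : ∀ b .{{_ : NonZero b}} (L : List ℕ) (φ : ℕ → ℕ) →
  ∑< b (λ z → mult b L z * φ z) ≡ sum (map (λ a → φ (a % b)) L)
∑-mult b []      φ = trans (∑-const b 0) (*-zeroʳ b)
∑-mult b (a ∷ L) φ = trans
  (∑-cong b (λ z → *-distribʳ-+ (φ z) (ι (does (a % b ≟ z))) (mult b L z)))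
  (trans (∑-+ b (λ z → ι (does (a % b ≟ z)) * φ z) (λ z → mult b L z * φ z))
    (cong₂ _+_ (∑-δ b φ (m%n<n a b)) (∑-mult b L φ)))

sum-map-1 : (f : ℕ → ℕ) (L : List ℕ) → (∀ {a} → a ∈ L → f a ≡ 1) → sum (map f L) ≡ length L
sum-map-1 f []      f≡1 = refl
sum-map-1 f (a ∷ L) f≡1 = cong₂ _+_ (f≡1 (here refl)) (sum-map-1 f L (f≡1 ∘ there))

maximiser : (f : ℕ → ℕ) {x : ℕ} {L : List ℕ} → x ∈ L →
  ∃ λ m → m ∈ L × (∀ {a} → a ∈ L → f a ≤ f m)
maximiser f {L = a ∷ []}    _ = a , here refl , λ { (here refl) → ≤-refl }
maximiser f {L = a ∷ c ∷ L} _ with maximiser f {L = c ∷ L} (here refl)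
... | m , m∈ , max with ≤-total (f a) (f m)
...   | inj₁ fa≤fm = m , there m∈ , λ { (here refl) → fa≤fm ; (there p) → max p }
...   | inj₂ fm≤fa = a , here refl , λ { (here refl) → ≤-refl ; (there p) → ≤-trans (max p) fm≤fa }

-- Since the fold starts from `b`, the equation `gcds b R ≡ 1` says that the residues of `R`
-- generate ℤ/b.
gcds : ℕ → List ℕ → ℕ
gcds = foldr gcd

gcds∣base : ∀ b R → gcds b R ∣ b
gcds∣base b []      = ∣-refl
gcds∣base b (a ∷ R) = ∣-trans (gcd[m,n]∣n a (gcds b R)) (gcds∣base b R)

gcds∣∈ : ∀ b {R a} → a ∈ R → gcds b R ∣ a
gcds∣∈ b {a ∷ R} (here refl) = gcd[m,n]∣m a (gcds b R)
gcds∣∈ b {a ∷ R} (there p)   = ∣-trans (gcd[m,n]∣n a (gcds b R)) (gcds∣∈ b p)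

module Translations {b : ℕ} .{{_ : NonZero b}} (P : ℕ → Set)
  (per⁺ : ∀ i → P i → P (i + b)) (per⁻ : ∀ i → P (i + b) → P i) where

  Preserves : ℕ → Set
  Preserves z = ∀ y → P y → P (y + z)

  preserves-* : ∀ {z} → Preserves z → ∀ k → Preserves (k * z)
  preserves-* pz zero    y py = subst P (sym (+-identityʳ y)) py
  preserves-* {z} pz (suc k) y py =
    subst P (+-assoc y z (k * z)) (preserves-* pz k (y + z) (pz y py))

  per⁻-* : ∀ k i → P (i + k * b) → P i
  per⁻-* zero    i p = subst P (+-identityʳ i) p
  per⁻-* (suc k) i p = per⁻ i (per⁻-* k (i + b) (subst P (sym (+-assoc i b (k * b))) p))

  preserves-difference : ∀ d {u v} → d + v ≡ u → Preserves u → Preserves v → Preserves d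
  preserves-difference d {v = v} refl pu pv y py =
    -- Modulo `b`, subtracting `v` amounts to adding it b - 1 times; the surplus `v * b` is a
    -- multiple of the period.
    per⁻-* v (y + d) (subst P (eq y d v) (preserves-* pv (pred b) _ (pu y py)))
    where
    eq : ∀ y d v → y + (d + v) + pred b * v ≡ y + d + v * b
    eq y d v = trans (lemma y d v (pred b)) (cong (λ t → y + d + v * t) (suc-pred b))
      where
      lemma : ∀ y d v c → y + (d + v) + c * v ≡ y + d + v * suc c
      lemma = solve-∀

  preserves-gcd : ∀ u v → Preserves u → Preserves v → Preserves (gcd u v)
  preserves-gcd u v pu pv with Bézout.identity (gcd-GCD u v)
  ... | Bézout.+- x y eq = preserves-difference _ eq (preserves-* pu x) (preserves-* pv y)
  ... | Bézout.-+ x y eq = preserves-difference _ eq (preserves-* pv y) (preserves-* pu x)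

  preserves-gcds : ∀ R → (∀ {x} → x ∈ R → Preserves x) → Preserves (gcds b R)
  preserves-gcds []      pR = per⁺
  preserves-gcds (x ∷ R) pR = preserves-gcd x _ (pR (here refl)) (preserves-gcds R (pR ∘ there))

-- Level sets of the autocorrelation

module Growth {b : ℕ} .{{_ : NonZero b}} (B : ℕ → Bool) (per : Periodic b B)
  (R : List ℕ) (gcd≡1 : gcds b R ≡ 1) where

  open Autocorrelation B per public

  -- Otherwise the level set where `corr` is at least `s`, which contains 0, would be closed under
  -- translation by generators and hence be everything. Summing `corr` over a period would then give
  -- at least `b * s`, but the sum is `size * size`.
  exit : ∀ s → s ≤ size → size * size < b * s →
    ∃ λ v → ∃ λ x → x ∈ R × s ≤ corr v × corr (v + x) < s
  exit s s≤size small
    with anyUpTo? (λ v → any? (λ x → (s ≤? corr v) ×-dec (corr (v + x) <? s)) R) b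
  ... | yes (v , _ , p) = let x , x∈R , q = find p in v , x , x∈R , q
  ... | no stuck = contradiction size²≥ (<⇒≱ small)
    where
    open Translations {b} (λ y → s ≤ corr y)
      (λ i → subst (s ≤_) (sym (corr-periodic i))) (λ i → subst (s ≤_) (corr-periodic i))

    closed : ∀ {x} → x ∈ R → Preserves x
    -- The search above only covers v < b, so `y` is replaced by its residue.
    closed {x} x∈R y s≤ = ≮⇒≥ λ lt → stuck (y % b , m%n<n y b , lose x∈R
      ( subst (s ≤_) (sym (periodic-% corr-periodic y)) s≤
      , subst (_< s) (trans (cong corr (+-comm y x))
          (trans (sym (periodic-% {f = λ i → corr (x + i)} (λ i → trans (cong corr (sym (+-assoc x i b))) (corr-periodic (x + i))) y))
            (cong corr (+-comm x (y % b))))) lt))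

    everywhere : ∀ y → s ≤ corr y
    everywhere y = subst (λ j → s ≤ corr j) (*-identityʳ y)
      (preserves-* (subst Preserves gcd≡1 (preserves-gcds R closed)) y 0
        (subst (s ≤_) (sym corr-0) s≤size))

    size²≥ : b * s ≤ size * size
    size²≥ = subst₂ _≤_ (∑-const b s) ∑-corr (∑-mono b everywhere)

  size²<b*s : 2 * size ≤ b → ∀ {s} → s ≤ size → size < 2 * s → size * size < b * s
  size²<b*s 2size≤b {s} s≤ lt = <-≤-trans (*-monoʳ-< size {{>-nonZero (≤-<-trans z≤n pos)}} lt)
    (≤-trans (≤-reflexive (eq size s)) (*-monoˡ-≤ s 2size≤b))
    where
    pos : 0 < size
    pos = ≰⇒> λ { z → contradiction (≤-trans lt (*-monoʳ-≤ 2 (≤-trans s≤ z))) λ () }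
    eq : ∀ a s → a * (2 * s) ≡ 2 * a * s
    eq = solve-∀

  module Levels (2size≤b : 2 * size ≤ b)
    (h : ℕ) (mult≤h : ∀ z → mult b R z ≤ h)
    (ℓ : ℕ) (1≤ℓ : 1 ≤ ℓ) (gain≤ℓ : ∀ {x} → x ∈ R → gain x ≤ ℓ) where

    above : ℕ → ℕ
    above t = ∑< b (λ y → ι (does (t ≤? corr y)))

    -- The exit point v at height t + ℓ has `corr v` in [t + ℓ, t + 2ℓ), as one step changes `corr`
    -- by at most ℓ. Hence all v + a with a in `R` have `corr` in the band [t, t + 3ℓ). Each residue
    -- arises from at most `h` entries a, so the band contains at least |R| / h residues.
    level : ∀ t → t + ℓ ≤ size → size < 2 * (t + ℓ) →
      length R + h * above (t + 3 * ℓ) ≤ h * above t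
    level t le lt with exit (t + ℓ) le (size²<b*s 2size≤b le lt)
    ... | v , x , x∈R , s≤v , vx<s = begin
      length R + h * above (t + 3 * ℓ)   ≤⟨ +-monoˡ-≤ _ count ⟩
      h * ∑< b band + h * above (t + 3 * ℓ) ≡⟨ *-distribˡ-+ h _ _ ⟨
      h * (∑< b band + above (t + 3 * ℓ))   ≡⟨ cong (h *_) (∑-+ b _ _) ⟨
      h * ∑< b (λ y → band y + ι (does (t + 3 * ℓ ≤? corr y)))
        ≡⟨ cong (h *_) (∑-cong b (λ y → split (corr y))) ⟩
      h * above t ∎
      where
      open ≤-Reasoning

      inBand : ℕ → ℕ
      inBand c = ι (does (t ≤? c) ∧ not (does (t + 3 * ℓ ≤? c)))

      inBand≡1 : ∀ {c} → t ≤ c → c < t + 3 * ℓ → inBand c ≡ 1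
      inBand≡1 {c} lo hi rewrite dec-true (t ≤? c) lo | dec-false (t + 3 * ℓ ≤? c) (<⇒≱ hi) = refl

      band : ℕ → ℕ
      band y = inBand (corr y)

      split : ∀ c → inBand c + ι (does (t + 3 * ℓ ≤? c)) ≡ ι (does (t ≤? c))
      split c with t ≤? c | t + 3 * ℓ ≤? c
      ... | yes p | yes q rewrite dec-true (t ≤? c) p | dec-true (t + 3 * ℓ ≤? c) q = refl
      ... | yes p | no ¬q rewrite dec-true (t ≤? c) p | dec-false (t + 3 * ℓ ≤? c) ¬q = refl
      ... | no ¬p | yes q = contradiction (≤-trans (m≤m+n t (3 * ℓ)) q) ¬p
      ... | no ¬p | no ¬q rewrite dec-false (t ≤? c) ¬p | dec-false (t + 3 * ℓ ≤? c) ¬q = refl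

      v<s+ℓ : corr v < t + ℓ + ℓ
      v<s+ℓ = ≤-<-trans (corr-≤-+ v x) (+-mono-<-≤ vx<s (gain≤ℓ x∈R))

      band≡1 : ∀ {a} → a ∈ R → band (v + a) ≡ 1
      band≡1 {a} a∈R = inBand≡1 lower upper
        where
        lower : t ≤ corr (v + a)
        lower = +-cancelʳ-≤ ℓ _ _ (≤-trans s≤v (≤-trans (corr-≤-+ v a) (+-monoʳ-≤ _ (gain≤ℓ a∈R))))
        upper : corr (v + a) < t + 3 * ℓ
        upper = subst (corr (v + a) <_) (eq t ℓ)
          (≤-<-trans (corr-+-≤ v a) (+-mono-<-≤ v<s+ℓ (gain≤ℓ a∈R)))
          where
          eq : ∀ t ℓ → t + ℓ + ℓ + ℓ ≡ t + 3 * ℓ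
          eq = solve-∀

      band-periodic : Periodic b band
      band-periodic i = cong inBand (corr-periodic i)

      count : length R ≤ h * ∑< b band
      count = begin
        length R                                      ≡⟨ sum-map-1 _ R (λ {a} a∈R → trans
                                                           (periodic-% (periodic-shift band-periodic v) a)
                                                           (trans (cong band (+-comm a v)) (band≡1 a∈R))) ⟨
        sum (map (λ a → band (a % b + v)) R)          ≡⟨ ∑-mult b R (λ z → band (z + v)) ⟨
        ∑< b (λ z → mult b R z * band (z + v))        ≤⟨ ∑-mono b (λ z → *-monoˡ-≤ _ (mult≤h z)) ⟩
        ∑< b (λ z → h * band (z + v))                 ≡⟨ ∑-*ˡ b h _ ⟩
        h * ∑< b (λ z → band (z + v))                 ≡⟨ cong (h *_) (∑-shift band-periodic v) ⟩
        h * ∑< b band                                 ∎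

    -- Stacked bands of height 3ℓ are disjoint, so their contributions add up. Staying above half of
    -- `size` keeps `exit` applicable.
    levels : ∀ J t → t + J * (3 * ℓ) ≤ size → size ≤ 2 * t → J * length R ≤ h * above t
    levels zero    t le ge = z≤n
    levels (suc J) t le ge = ≤-trans
      (+-monoʳ-≤ (length R) (levels J (t + 3 * ℓ)
        (≤-trans (≤-reflexive (+-assoc t _ _)) le)
        (≤-trans ge (*-monoʳ-≤ 2 (m≤m+n t _)))))
      (level t
        (≤-trans (+-monoʳ-≤ t (≤-trans (m≤m+n ℓ _) (m≤m+n (3 * ℓ) _))) le)
        (≤-<-trans ge (*-monoʳ-< 2 (m<m+n t 1≤ℓ))))

    -- Markov's inequality for `corr`, whose total is `size * size`.
    above-bound : ∀ {t} → 1 ≤ size → size ≤ 2 * t → above t ≤ 2 * size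
    above-bound {t} pos ge = *-cancelˡ-≤ size {{>-nonZero pos}} (begin
      size * above t                ≤⟨ *-monoˡ-≤ (above t) ge ⟩
      2 * t * above t               ≡⟨ *-assoc 2 t _ ⟩
      2 * (t * above t)             ≡⟨ cong (2 *_) (∑-*ˡ b t _) ⟨
      2 * ∑< b (λ y → t * ι (does (t ≤? corr y))) ≤⟨ *-monoʳ-≤ 2 (∑-mono b (λ y → markov (corr y))) ⟩
      2 * ∑< b corr                 ≡⟨ cong (2 *_) ∑-corr ⟩
      2 * (size * size)             ≡⟨ eq size ⟩
      size * (2 * size)             ∎)
      where
      open ≤-Reasoning
      eq : ∀ a → 2 * (a * a) ≡ a * (2 * a)
      eq = solve-∀
      markov : ∀ c → t * ι (does (t ≤? c)) ≤ c
      markov c with t ≤? c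
      ... | yes p rewrite dec-true (t ≤? c) p = ≤-trans (≤-reflexive (*-identityʳ t)) p
      ... | no ¬p rewrite dec-false (t ≤? c) ¬p = ≤-trans (≤-reflexive (*-zeroʳ t)) z≤n

    levels-bound : ∀ J → 1 ≤ size → J * (6 * ℓ) ≤ size → J * length R ≤ h * (2 * size)
    levels-bound J pos le = ≤-trans
      (levels J t (≤-reflexive (m∸n+n≡m half)) size≤2t)
      (*-monoʳ-≤ h (above-bound {t} pos size≤2t))
      where
      -- The descent passes J bands below `size`; by hypothesis they use up at most half of it.
      t : ℕ
      t = size ∸ J * (3 * ℓ)
      half : J * (3 * ℓ) ≤ size
      half = ≤-trans (*-monoʳ-≤ J (*-monoˡ-≤ ℓ (m≤m+n 3 3))) le
      size≤2t : size ≤ 2 * t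
      size≤2t = +-cancelʳ-≤ (J * (6 * ℓ)) _ _ (begin
        size + J * (6 * ℓ)              ≤⟨ +-monoʳ-≤ size le ⟩
        size + size                     ≡⟨ cong₂ _+_ (sym (m∸n+n≡m half)) (sym (m∸n+n≡m half)) ⟩
        t + J * (3 * ℓ) + (t + J * (3 * ℓ)) ≡⟨ eq t J ℓ ⟩
        2 * t + J * (6 * ℓ)             ∎)
        where
        open ≤-Reasoning
        eq : ∀ t J ℓ → t + J * (3 * ℓ) + (t + J * (3 * ℓ)) ≡ 2 * t + J * (6 * ℓ)
        eq = solve-∀

  -- Take x of maximal gain ℓ and J = `size / (6 * ℓ)`. If J is 0, then `size` itself is less than
  -- 6ℓ. Otherwise `size` is at most 12Jℓ, and `levels-bound` gives J |R| ≤ 2h · 12Jℓ, from which J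
  -- cancels.
  large-gain : ∀ h → 1 ≤ h → (∀ z → mult b R z ≤ h) → 1 ≤ size → 2 * size ≤ b →
    ∃ λ x → x ∈ R × 1 ≤ gain x ×
      (size < 24 * (h * gain x) ⊎ length R ≤ 24 * (h * gain x))
  large-gain h 1≤h mult≤h pos 2size≤b
    with exit size ≤-refl (size²<b*s 2size≤b ≤-refl (m<m+n size (≤-trans pos (m≤m+n size 0))))
  ... | v , x₀ , x₀∈R , ge , lt with maximiser gain x₀∈R
  ... | x , x∈R , max = x , x∈R , 1≤ℓ , alternatives
    where
    ℓ : ℕ
    ℓ = gain x

    -- At the exit from the top level `s = size`, the step x₀ makes `corr` drop strictly, so its
    -- gain is positive.
    1≤ℓ : 1 ≤ ℓ
    1≤ℓ = ≤-trans (≰⇒> λ gain≤0 → <⇒≱ lt (≤-trans ge (≤-trans (corr-≤-+ v x₀)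
      (≤-trans (+-monoʳ-≤ _ gain≤0) (≤-reflexive (+-identityʳ _)))))) (max x₀∈R)

    open Levels 2size≤b h mult≤h ℓ 1≤ℓ max

    alternatives : size < 24 * (h * ℓ) ⊎ length R ≤ 24 * (h * ℓ)
    alternatives = by-cases (size / (6 * ℓ)) refl
      where
      instance
        6ℓ≢0 : NonZero (6 * ℓ)
        6ℓ≢0 = m*n≢0 6 ℓ {{_}} {{>-nonZero 1≤ℓ}}
      r<6ℓ : size % (6 * ℓ) < 6 * ℓ
      r<6ℓ = m%n<n size (6 * ℓ)
      by-cases : ∀ J → J ≡ size / (6 * ℓ) → size < 24 * (h * ℓ) ⊎ length R ≤ 24 * (h * ℓ)
      by-cases zero eq = inj₁ (begin-strict
        size                              ≡⟨ m≡m%n+[m/n]*n size (6 * ℓ) ⟩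
        size % (6 * ℓ) + size / (6 * ℓ) * (6 * ℓ) ≡⟨ cong (λ J → size % (6 * ℓ) + J * (6 * ℓ)) eq ⟨
        size % (6 * ℓ) + 0                ≡⟨ +-identityʳ _ ⟩
        size % (6 * ℓ)                    <⟨ r<6ℓ ⟩
        6 * ℓ                             ≤⟨ *-mono-≤ (m≤m+n 6 18) (m≤n*m ℓ h {{>-nonZero 1≤h}}) ⟩
        24 * (h * ℓ)                      ∎)
        where open ≤-Reasoning
      by-cases (suc J) eq = inj₂ (*-cancelˡ-≤ (suc J) (begin
        suc J * length R                  ≤⟨ levels-bound (suc J) pos
                                               (subst (λ K → K * (6 * ℓ) ≤ size) (sym eq) (m/n*n≤m size (6 * ℓ))) ⟩
        h * (2 * size)                    ≤⟨ *-monoʳ-≤ h (*-monoʳ-≤ 2 size≤) ⟩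
        h * (2 * (suc J * (12 * ℓ)))      ≡⟨ rearrange h J ℓ ⟩
        suc J * (24 * (h * ℓ))            ∎))
        where
        open ≤-Reasoning
        rearrange : ∀ h J ℓ → h * (2 * (suc J * (12 * ℓ))) ≡ suc J * (24 * (h * ℓ))
        rearrange = solve-∀
        size≤ : size ≤ suc J * (12 * ℓ)
        size≤ = begin
          size                            ≡⟨ m≡m%n+[m/n]*n size (6 * ℓ) ⟩
          size % (6 * ℓ) + size / (6 * ℓ) * (6 * ℓ) ≡⟨ cong (λ K → size % (6 * ℓ) + K * (6 * ℓ)) eq ⟨
          size % (6 * ℓ) + suc J * (6 * ℓ) ≤⟨ +-monoˡ-≤ _ (≤-trans (<⇒≤ r<6ℓ) (m≤m+n (6 * ℓ) (J * (6 * ℓ)))) ⟩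
          suc J * (6 * ℓ) + suc J * (6 * ℓ) ≡⟨ double J ℓ ⟩
          suc J * (12 * ℓ)                ∎
          where
          double : ∀ J ℓ → suc J * (6 * ℓ) + suc J * (6 * ℓ) ≡ suc J * (12 * ℓ)
          double = solve-∀

-- Zero sums modulo b

-- reach b S is the set of residues −s mod b, for s a (possibly empty) subset sum of S.
reach : ℕ → List ℕ → ℕ → Bool
reach b []      i = does (b ∣? i)
reach b (x ∷ S) i = reach b S i ∨ reach b S (i + x)

reach-periodic : ∀ b S → Periodic b (reach b S)
reach-periodic b [] i with b ∣? i
... | yes b∣i = dec-true (b ∣? (i + b)) (∣m∣n⇒∣m+n b∣i ∣-refl)
... | no  b∤i = dec-false (b ∣? (i + b))
  λ p → b∤i (∣m+n∣m⇒∣n (subst (b ∣_) (+-comm i b) p) ∣-refl)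
reach-periodic b (x ∷ S) i =
  cong₂ _∨_ (reach-periodic b S i) (periodic-shift (reach-periodic b S) x i)

reach-sound : ∀ b S i → reach b S i ≡ true →
  ∃ λ S₁ → ∃ λ S₂ → S ↭ S₁ ++ S₂ × b ∣ i + sum S₁
reach-sound b [] i eq with b ∣? i
... | yes b∣i = [] , [] , refl , subst (b ∣_) (sym (+-identityʳ i)) b∣i
reach-sound b (x ∷ S) i eq with reach b S i in eq₁ | reach b S (i + x) in eq₂
... | true | _ = let S₁ , S₂ , p , q = reach-sound b S i eq₁
                 in S₁ , x ∷ S₂ , ↭-trans (prep x p) (↭-sym (shift x S₁ S₂)) , q
... | false | true = let S₁ , S₂ , p , q = reach-sound b S (i + x) eq₂
                     in x ∷ S₁ , S₂ , prep x p , subst (b ∣_) (+-assoc i x (sum S₁)) q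

module Reach (b : ℕ) (S : List ℕ) = Autocorrelation (reach b S) (reach-periodic b S)

-- Adjoining x replaces the set X by its union with X - x.
reach-∷-size : ∀ b x S → Reach.size b (x ∷ S) ≡ Reach.size b S + Reach.gain b S x
reach-∷-size b x S = trans
  (∑-cong b (λ i → pointwise (reach b S i) (reach b S (i + x)))) (∑-+ b _ _)
  where
  pointwise : ∀ p q → ι (p ∨ q) ≡ ι p + ι (not p ∧ q)
  pointwise true  q = refl
  pointwise false q = refl

reach-[]-size : ∀ b → .{{_ : NonZero b}} → 1 ≤ Reach.size b []
reach-[]-size (suc n) = subst (1 ≤_) (sym (∑-suc n _)) (m≤m+n 1 _)

mult-↭ : ∀ b .{{_ : NonZero b}} {L L′} → L ↭ L′ → ∀ z → mult b L z ≡ mult b L′ z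
mult-↭ b p z = sum-↭ (map⁺ _ p)

mult-++ : ∀ b .{{_ : NonZero b}} S R z → mult b (S ++ R) z ≡ mult b S z + mult b R z
mult-++ b S R z = trans (cong sum (map-++ _ S R)) (sum-++ (map _ S) (map _ R))

mult-part : ∀ b .{{_ : NonZero b}} {L} S {R} → L ↭ S ++ R → ∀ z → mult b R z ≤ mult b L z
mult-part b S {R} p z = subst (mult b R z ≤_)
  (sym (trans (mult-↭ b p z) (mult-++ b S R z))) (m≤n+m _ (mult b S z))

-- Subsets are given by splittings up to permutation, since the argument regroups the pieces freely;
-- `zeroSum⇒subsetSum` returns to sublists.
ZeroSum : ℕ → List ℕ → Set
ZeroSum b L = ∃ λ S → ∃ λ T → S ≢ [] × L ↭ S ++ T × b ∣ sum S

zeroSum-part : ∀ {b L} S {R} → L ↭ S ++ R → ZeroSum b R → ZeroSum b L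
zeroSum-part S p (U , V , U≢[] , q , b∣) =
  U , S ++ V , U≢[] , ↭-trans p (↭-trans (++⁺ˡ S q) (shifts S U)) , b∣

length-split : ∀ {L : List ℕ} S {R} → L ↭ S ++ R → length L ≡ length S + length R
length-split S p = trans (↭-length p) (length-++ S)

∈⇒↭∷ : ∀ {x : ℕ} {R} → x ∈ R → ∃ λ R′ → R ↭ x ∷ R′
∈⇒↭∷ x∈R with ∈-∃++ x∈R
... | ys , zs , refl = ys ++ zs , shift _ ys zs

module Expansion (b : ℕ) .{{_ : NonZero b}} (h : ℕ) (1≤h : 1 ≤ h) (k : ℕ)
  (k-large : 24 * (h * b) < suc k * suc k) where

  Expanded : List ℕ → Set
  Expanded L = ∃ λ S → ∃ λ R → L ↭ S ++ R × length S ≤ k ×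
    (b < 2 * Reach.size b S ⊎ gcds b R ≢ 1)

  module _ (L : List ℕ) (mult≤h : ∀ z → mult b L z ≤ h) (long : k + suc k ≤ length L) where

    -- Each step enlarges reach b S by ≫ j / h, where j = length S; this gives size ≫ j² / h.
    grow : ∀ i S R → i + length S ≡ k → L ↭ S ++ R → suc (length S) ≤ Reach.size b S →
      suc (length S) * suc (length S) ≤ 48 * (h * Reach.size b S) → Expanded L
    grow i S R i+j≡k p linear quadratic with 2 * Reach.size b S ≤? b | gcds b R ≟ 1
    ... | no big    | _        = S , R , p , m+n≤o⇒n≤o i (≤-reflexive i+j≡k) , inj₁ (≰⇒> big)
    ... | yes small | no gcd≢1 = S , R , p , m+n≤o⇒n≤o i (≤-reflexive i+j≡k) , inj₂ gcd≢1
    -- All k steps are spent, so the quadratic invariant reads (k + 1)² ≤ 48 h s ≤ 24 h b, against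
    -- `k-large`.
    grow zero S R refl p linear quadratic | yes small | yes _ =
      contradiction (≤-trans quadratic (begin
        48 * (h * s)       ≡⟨ rearrange 24 h s ⟩
        24 * (h * (2 * s)) ≤⟨ *-monoʳ-≤ 24 (*-monoʳ-≤ h small) ⟩
        24 * (h * b)       ∎)) (<⇒≱ k-large)
      where
      open ≤-Reasoning
      s : ℕ
      s = Reach.size b S
      rearrange : ∀ c h s → c * 2 * (h * s) ≡ c * (h * (2 * s))
      rearrange = solve-∀
    grow (suc i) S R refl p linear quadratic | yes small | yes gcd≡1 =
      let x , x∈R , 1≤gain , alternatives =
            Growth.large-gain (reach b S) (reach-periodic b S) R gcd≡1 h 1≤h
              (λ z → ≤-trans (mult-part b S p z) (mult≤h z)) (≤-trans (s≤s z≤n) linear) small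
          R′ , q = ∈⇒↭∷ x∈R
      in extend x R′ q 1≤gain (gain-large _ alternatives)
      where
      open ≤-Reasoning
      j s : ℕ
      j = length S
      s = Reach.size b S

      -- The left side of the quadratic invariant grows by less than 2 (j + 2), while 48 h G is at
      -- least that much.
      square : ∀ j → suc (suc j) * suc (suc j) + 1 ≡ suc j * suc j + 2 * (2 + j)
      square = solve-∀

      rearrange : ∀ c h s G → c * 2 * (h * s) + 2 * (c * (h * G)) ≡ c * 2 * (h * (s + G))
      rearrange = solve-∀

      R-long : 2 + j ≤ length R
      R-long = +-cancelˡ-≤ j _ _ (begin
        j + (2 + j)                 ≤⟨ +-mono-≤ (m≤n+m j (suc i)) (s≤s (s≤s (m≤n+m j i))) ⟩
        suc i + j + suc (suc i + j) ≤⟨ long ⟩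
        length L                    ≡⟨ length-split S p ⟩
        j + length R                ∎)

      -- In the first alternative the linear invariant bounds s below by j + 1; in the second,
      -- enough of `L` is left in `R`.
      gain-large : ∀ G → s < 24 * (h * G) ⊎ length R ≤ 24 * (h * G) → 2 + j ≤ 24 * (h * G)
      gain-large G (inj₁ lt) = ≤-trans (s≤s linear) lt
      gain-large G (inj₂ le) = ≤-trans R-long le

      extend : ∀ x R′ → R ↭ x ∷ R′ → 1 ≤ Reach.gain b S x →
        2 + j ≤ 24 * (h * Reach.gain b S x) → Expanded L
      extend x R′ q 1≤gain gain-large = grow i (x ∷ S) R′ (+-suc i j)
        (↭-trans p (↭-trans (++⁺ˡ S q) (shift x S R′)))
        (subst (2 + j ≤_) (sym (reach-∷-size b x S))
          (≤-trans (≤-reflexive (+-comm 1 (suc j))) (+-mono-≤ linear 1≤gain)))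
        (begin
          (2 + j) * (2 + j)                 ≤⟨ m≤m+n _ 1 ⟩
          (2 + j) * (2 + j) + 1             ≡⟨ square j ⟩
          suc j * suc j + 2 * (2 + j)       ≤⟨ +-mono-≤ quadratic (*-monoʳ-≤ 2 gain-large) ⟩
          48 * (h * s) + 2 * (24 * (h * G)) ≡⟨ rearrange 24 h s G ⟩
          48 * (h * (s + G))                ≡⟨ cong (λ t → 48 * (h * t)) (reach-∷-size b x S) ⟨
          48 * (h * Reach.size b (x ∷ S))   ∎)
        where
        G : ℕ
        G = Reach.gain b S x

    expand : Expanded L
    expand = grow k [] L (+-identityʳ k) refl (reach-[]-size b)
      (*-mono-≤ {1} {48} {1} (m≤m+n 1 47) (*-mono-≤ {1} {h} {1} 1≤h (reach-[]-size b)))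

-- Two sets of more than half the residues meet, which solves x + u₁ + u₂ ≡ 0 with uᵢ a possibly
-- empty subset sum of Sᵢ. The spare element x makes the zero sum nonempty.
combine : ∀ b .{{_ : NonZero b}} {L} S₁ S₂ x R → L ↭ S₁ ++ S₂ ++ x ∷ R →
  b < 2 * Reach.size b S₁ → b < 2 * Reach.size b S₂ → ZeroSum b L
combine b {L} S₁ S₂ x R p big₁ big₂
  -- The reflection of [0, b) is i ↦ b - 1 - i; the `suc` in `suc x` compensates for the -1, so the
  -- two arguments add up to b + x.
  with pigeonhole b (λ i → reach b S₁ (i + suc x)) (λ i → reach b S₂ (b ∸ suc i)) sizes
  where
  s₁ s₂ : ℕ
  s₁ = Reach.size b S₁
  s₂ = Reach.size b S₂
  sizes : b < ∑< b (λ i → ι (reach b S₁ (i + suc x))) + ∑< b (λ i → ι (reach b S₂ (b ∸ suc i)))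
  sizes = subst (b <_)
    (sym (cong₂ _+_ (∑-shift (λ i → cong ι (reach-periodic b S₁ i)) (suc x))
                    (∑-reverse b (ι ∘ reach b S₂))))
    (*-cancelˡ-< 2 b (s₁ + s₂) (subst₂ _<_ (double b) (sym (*-distribˡ-+ 2 s₁ s₂)) (+-mono-< big₁ big₂)))
    where
    double : ∀ b → b + b ≡ 2 * b
    double = solve-∀
... | i , i<b , r₁ , r₂ with reach-sound b S₁ _ r₁ | reach-sound b S₂ _ r₂
...   | U₁ , V₁ , p₁ , d₁ | U₂ , V₂ , p₂ , d₂ =
  x ∷ U₁ ++ U₂ , V₁ ++ V₂ ++ R , (λ ()) , perm , b∣
  where
  perm : L ↭ (x ∷ U₁ ++ U₂) ++ V₁ ++ V₂ ++ R
  perm = begin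
    L                                 ↭⟨ p ⟩
    S₁ ++ S₂ ++ x ∷ R                 ↭⟨ ++⁺ˡ S₁ (shift x S₂ R) ⟩
    S₁ ++ x ∷ S₂ ++ R                 ↭⟨ shift x S₁ (S₂ ++ R) ⟩
    x ∷ S₁ ++ S₂ ++ R                 ↭⟨ prep x (++⁺ p₁ (Perm.++⁺ʳ R p₂)) ⟩
    x ∷ (U₁ ++ V₁) ++ (U₂ ++ V₂) ++ R ≡⟨ cong (x ∷_) (trans (++-assoc U₁ V₁ _) (cong (λ T → U₁ ++ V₁ ++ T) (++-assoc U₂ V₂ R))) ⟩
    x ∷ U₁ ++ V₁ ++ U₂ ++ V₂ ++ R     ↭⟨ prep x (++⁺ˡ U₁ (shifts V₁ U₂)) ⟩
    x ∷ U₁ ++ U₂ ++ V₁ ++ V₂ ++ R     ≡⟨ cong (x ∷_) (++-assoc U₁ U₂ _) ⟨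
    x ∷ (U₁ ++ U₂) ++ V₁ ++ V₂ ++ R   ∎
    where open PermutationReasoning
  b∣ : b ∣ x + sum (U₁ ++ U₂)
  b∣ = ∣m+n∣m⇒∣n (subst (b ∣_) total (∣m∣n⇒∣m+n d₁ d₂)) ∣-refl
    where
    rearrange : ∀ i x u c v → i + suc x + u + (c + v) ≡ suc i + c + (x + (u + v))
    rearrange = solve-∀
    total : i + suc x + sum U₁ + (b ∸ suc i + sum U₂) ≡ b + (x + sum (U₁ ++ U₂))
    total = trans (rearrange i x (sum U₁) (b ∸ suc i) (sum U₂))
      (cong₂ _+_ (m+[n∸m]≡n i<b) (cong (x +_) (sym (sum-++ U₁ U₂))))

unscale : ∀ d R → (∀ {a} → a ∈ R → d ∣ a) → ∃ λ R′ → R ≡ map (_* d) R′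
unscale d []      d∣ = [] , refl
unscale d (a ∷ R) d∣ with d∣ (here refl) | unscale d R (d∣ ∘ there)
... | divides q refl | R′ , refl = q ∷ R′ , refl

sum-scale : ∀ d S → sum (map (_* d) S) ≡ sum S * d
sum-scale d []      = refl
sum-scale d (a ∷ S) = trans (cong (a * d +_) (sum-scale d S)) (sym (*-distribʳ-+ d a (sum S)))

-- Multiplication by `d` embeds ℤ/q into ℤ/(qd), so multiplicities survive the division by `d`.
mult-scale : ∀ q d .{{_ : NonZero q}} .{{_ : NonZero d}} .{{_ : NonZero (q * d)}} R z →
  mult (q * d) (map (_* d) R) (z * d) ≡ mult q R z
mult-scale q d []      z = refl
mult-scale q d (a ∷ R) z = cong₂ _+_ (cong ι same) (mult-scale q d R z)
  where
  same : does ((a * d) % (q * d) ≟ z * d) ≡ does (a % q ≟ z)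
  same with a % q ≟ z
  ... | yes eq rewrite dec-true (a % q ≟ z) eq =
    dec-true ((a * d) % (q * d) ≟ z * d) (trans (sym (m%n*o≡m*o%[n*o] a q d)) (cong (_* d) eq))
  ... | no ¬eq rewrite dec-false (a % q ≟ z) ¬eq =
    dec-false ((a * d) % (q * d) ≟ z * d)
      λ eq → ¬eq (*-cancelʳ-≡ _ _ d (trans (m%n*o≡m*o%[n*o] a q d) eq))

zeroSum-scale : ∀ {q} d {R} → ZeroSum q R → ZeroSum (q * d) (map (_* d) R)
zeroSum-scale d (S , T , S≢[] , p , q∣) =
  map (_* d) S , map (_* d) T , nonempty S S≢[] ,
  ↭-trans (map⁺ (_* d) p) (↭-reflexive (map-++ (_* d) S T)) ,
  subst (_ ∣_) (sym (sum-scale d S)) (*-monoˡ-∣ d q∣)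
  where
  nonempty : ∀ S → S ≢ [] → map (_* d) S ≢ []
  nonempty []      ne _ = ne refl
  nonempty (_ ∷ _) ne ()

ZeroSumBound : ℕ → Set
ZeroSumBound b = .{{_ : NonZero b}} → ∀ h L → 1 ≤ h → (∀ z → mult b L z ≤ h) →
  64 * (24 * (h * b)) < length L * length L → ZeroSum b L

-- When R lies in a proper subgroup, divide by its index; the length drops by a factor 3/4 only,
-- so that the hypothesis survives, as 2 (3/4)² > 1.
descend : ∀ b .{{_ : NonZero b}} → (∀ {q} → q < b → ZeroSumBound q) →
  ∀ h L → 1 ≤ h → (∀ z → mult b L z ≤ h) → 64 * (24 * (h * b)) < length L * length L →
  ∀ S R → L ↭ S ++ R → 3 * length L ≤ 4 * length R → gcds b R ≢ 1 → ZeroSum b L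
descend b rec h L 1≤h mult≤h long S R p R-long gcd≢1 =
  zeroSum-part S p (go (gcds b R) gcd≢1 (gcds∣base b R) (gcds∣∈ b))
  where
  mult-R : ∀ z → mult b R z ≤ h
  mult-R z = ≤-trans (mult-part b S p z) (mult≤h z)

  go : ∀ d → d ≢ 1 → d ∣ b → (∀ {a} → a ∈ R → d ∣ a) → ZeroSum b R
  go zero d≢1 0∣b _ = contradiction (0∣⇒≡0 0∣b) (≢-nonZero⁻¹ b)
  go (suc zero) d≢1 _ _ = contradiction refl d≢1
  go d@(suc (suc d-2)) _ (divides q refl) d∣R with unscale d R d∣R
  ... | R′ , refl = zeroSum-scale d (rec q<qd {{q≢0}} h R′ 1≤h
      (λ z → subst (_≤ h) (mult-scale q d {{q≢0}} R′ z) (mult-R (z * d))) R′-long)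
    where
    q≢0 : NonZero q
    q≢0 = m*n≢0⇒m≢0 q
    q<qd : q < q * d
    q<qd = m<m*n q d {{q≢0}} (s≤s (s≤s z≤n))
    m r : ℕ
    m = length L
    r = length R′
    open ≤-Reasoning
    3m≤4r : 3 * m ≤ 4 * r
    3m≤4r = subst (λ t → 3 * m ≤ 4 * t) (length-map (_* d) R′) R-long
    R′-long : 64 * (24 * (h * q)) < r * r
    R′-long = *-cancelˡ-< 16 _ _ (begin-strict
      -- Here 18 = 9 · 2, and the factor 2 is absorbed by d ≥ 2.
      16 * (64 * (24 * (h * q)))       ≤⟨ *-monoˡ-≤ (64 * (24 * (h * q))) (m≤m+n 16 2) ⟩
      18 * (64 * (24 * (h * q)))       ≡⟨ eq₁ 9 64 24 h q ⟩
      9 * (64 * (24 * (h * (q * 2))))  ≤⟨ *-monoʳ-≤ 9 (*-monoʳ-≤ 64 (*-monoʳ-≤ 24 (*-monoʳ-≤ h (*-monoʳ-≤ q (s≤s (s≤s z≤n)))))) ⟩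
      9 * (64 * (24 * (h * (q * d))))  <⟨ *-monoʳ-< 9 long ⟩
      9 * (m * m)                      ≡⟨ eq₂ 3 m ⟩
      3 * m * (3 * m)                  ≤⟨ *-mono-≤ 3m≤4r 3m≤4r ⟩
      4 * r * (4 * r)                  ≡⟨ eq₂ 4 r ⟨
      16 * (r * r)                     ∎)
      where
      eq₁ : ∀ a b c h q → a * 2 * (b * (c * (h * q))) ≡ a * (b * (c * (h * (q * 2))))
      eq₁ = solve-∀
      eq₂ : ∀ c m → c * c * (m * m) ≡ c * m * (c * m)
      eq₂ = solve-∀

-- Expand twice, using at most k = m / 8 elements each time. If some remainder fails to generate
-- ℤ/b, it still has at least 3m / 4 elements and `descend` applies; otherwise `combine` does.
zeroSum-bound : ∀ b → ZeroSumBound b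
zeroSum-bound = <-rec ZeroSumBound step
  where
  step : ∀ b → (∀ {q} → q < b → ZeroSumBound q) → ZeroSumBound b
  step b rec h L 1≤h mult≤h long = from-first (expand L mult≤h (≤-trans k+suck≤7k (≤-trans 7k≤8k 8k≤m)))
    where
    m k : ℕ
    m = length L
    k = m / 8
    open ≤-Reasoning

    8k≤m : 8 * k ≤ m
    8k≤m = ≤-trans (≤-reflexive (*-comm 8 k)) (m/n*n≤m m 8)

    m<8[k+1] : m < 8 * suc k
    m<8[k+1] = begin-strict
      m             ≡⟨ m≡m%n+[m/n]*n m 8 ⟩
      m % 8 + k * 8 <⟨ +-monoˡ-< (k * 8) (m%n<n m 8) ⟩
      suc k * 8     ≡⟨ *-comm (suc k) 8 ⟩
      8 * suc k     ∎

    -- The constant 64 is 8², from m < 8 (k + 1).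
    k-large : 24 * (h * b) < suc k * suc k
    k-large = *-cancelˡ-< 64 _ _ (begin-strict
      64 * (24 * (h * b))       <⟨ long ⟩
      m * m                     ≤⟨ *-mono-≤ (<⇒≤ m<8[k+1]) (<⇒≤ m<8[k+1]) ⟩
      8 * suc k * (8 * suc k)   ≡⟨ eq (suc k) ⟩
      64 * (suc k * suc k)      ∎)
      where
      eq : ∀ k → 8 * k * (8 * k) ≡ 64 * (k * k)
      eq = solve-∀

    1≤k : 1 ≤ k
    1≤k = positive k k-large
      where
      positive : ∀ k → 24 * (h * b) < suc k * suc k → 1 ≤ k
      positive zero lt = contradiction (≤-trans (*-mono-≤ (m≤m+n 1 23) (*-mono-≤ 1≤h (>-nonZero⁻¹ b))) (s≤s⁻¹ lt)) λ ()
      positive (suc k) _ = s≤s z≤n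

    k+suck≤7k : k + suc k ≤ 7 * k
    k+suck≤7k = +-monoʳ-≤ k (+-mono-≤ 1≤k (m≤m+n k _))

    7k≤8k : 7 * k ≤ 8 * k
    7k≤8k = *-monoˡ-≤ k (m≤m+n 7 1)

    open Expansion b h 1≤h k k-large

    first-long : ∀ S {R} → L ↭ S ++ R → length S ≤ k → 7 * k ≤ length R
    first-long S {R} p S≤k = +-cancelˡ-≤ k _ _ (begin
      8 * k               ≤⟨ 8k≤m ⟩
      m                   ≡⟨ length-split S p ⟩
      length S + length R ≤⟨ +-monoˡ-≤ _ S≤k ⟩
      k + length R        ∎)

    rest-long : ∀ S {R} → L ↭ S ++ R → length S ≤ k + k → 3 * m ≤ 4 * length R
    rest-long S {R} p S≤2k = +-cancelˡ-≤ m _ _ (begin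
      4 * m                       ≡⟨ cong (4 *_) (length-split S p) ⟩
      4 * (length S + length R)   ≤⟨ *-monoʳ-≤ 4 (+-monoˡ-≤ (length R) S≤2k) ⟩
      4 * (k + k + length R)      ≡⟨ eq k (length R) ⟩
      8 * k + 4 * length R        ≤⟨ +-monoˡ-≤ _ 8k≤m ⟩
      m + 4 * length R            ∎)
      where
      eq : ∀ k r → 4 * (k + k + r) ≡ 8 * k + 4 * r
      eq = solve-∀

    from-second : ∀ S₁ {R₁} → L ↭ S₁ ++ R₁ → length S₁ ≤ k → b < 2 * Reach.size b S₁ →
      Expanded R₁ → ZeroSum b L
    from-second S₁ {R₁} p₁ S₁≤k big₁ (S₂ , R₂ , p₂ , S₂≤k , outcome) = finish outcome R₂ refl
      where
      p : L ↭ (S₁ ++ S₂) ++ R₂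
      p = ↭-trans p₁ (↭-trans (++⁺ˡ S₁ p₂) (↭-reflexive (sym (++-assoc S₁ S₂ R₂))))
      R₂-long : 3 * m ≤ 4 * length R₂
      R₂-long = rest-long (S₁ ++ S₂) p
        (≤-trans (≤-reflexive (length-++ S₁)) (+-mono-≤ S₁≤k S₂≤k))
      finish : b < 2 * Reach.size b S₂ ⊎ gcds b R₂ ≢ 1 → ∀ R → R₂ ≡ R → ZeroSum b L
      finish (inj₂ gcd≢1) _ _ = descend b rec h L 1≤h mult≤h long (S₁ ++ S₂) R₂ p R₂-long gcd≢1
      finish (inj₁ big₂) (x ∷ R) refl = combine b S₁ S₂ x R (↭-trans p₁ (++⁺ˡ S₁ p₂)) big₁ big₂
      -- The spare element for `combine` exists because the remainder has at least 3m / 4 > 0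
      -- elements.
      finish (inj₁ big₂) [] refl = contradiction
        (≤-trans (≤-trans (≤-trans 1≤k (m≤n*m k 8)) 8k≤m) (≤-trans (m≤n*m m 3) R₂-long)) λ ()

    from-first : Expanded L → ZeroSum b L
    from-first (S₁ , R₁ , p₁ , S₁≤k , inj₂ gcd≢1) = descend b rec h L 1≤h mult≤h long S₁ R₁ p₁
      (rest-long S₁ p₁ (≤-trans S₁≤k (m≤m+n k k))) gcd≢1
    from-first (S₁ , R₁ , p₁ , S₁≤k , inj₁ big₁) = from-second S₁ p₁ S₁≤k big₁
      (expand R₁ (λ z → ≤-trans (mult-part b S₁ p₁ z) (mult≤h z))
        (≤-trans k+suck≤7k (first-long S₁ p₁ S₁≤k)))

-- From zero sums to subset sums

⊆-resp-↭ : ∀ {xs ys zs : List ℕ} → xs ↭ ys → zs ⊆ ys → ∃ λ ws → ws ⊆ xs × ws ↭ zs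
⊆-resp-↭ refl z⊆ = _ , z⊆ , refl
⊆-resp-↭ (prep x p) (_ ∷ʳ z⊆) = let _ , w⊆ , q = ⊆-resp-↭ p z⊆ in _ , x ∷ʳ w⊆ , q
⊆-resp-↭ (prep x p) (refl ∷ z⊆) = let _ , w⊆ , q = ⊆-resp-↭ p z⊆ in _ , refl ∷ w⊆ , prep x q
⊆-resp-↭ (swap x y p) (_ ∷ʳ _ ∷ʳ z⊆) =
  let _ , w⊆ , q = ⊆-resp-↭ p z⊆ in _ , x ∷ʳ y ∷ʳ w⊆ , q
⊆-resp-↭ (swap x y p) (_ ∷ʳ (refl ∷ z⊆)) =
  let _ , w⊆ , q = ⊆-resp-↭ p z⊆ in _ , refl ∷ (y ∷ʳ w⊆) , prep x q
⊆-resp-↭ (swap x y p) (refl ∷ (_ ∷ʳ z⊆)) =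
  let _ , w⊆ , q = ⊆-resp-↭ p z⊆ in _ , x ∷ʳ (refl ∷ w⊆) , prep y q
⊆-resp-↭ (swap x y p) (refl ∷ (refl ∷ z⊆)) =
  let _ , w⊆ , q = ⊆-resp-↭ p z⊆ in _ , refl ∷ (refl ∷ w⊆) , swap x y q
⊆-resp-↭ (↭.trans p₁ p₂) z⊆ =
  let _ , w⊆ , q = ⊆-resp-↭ p₂ z⊆
      _ , v⊆ , r = ⊆-resp-↭ p₁ w⊆
  in _ , v⊆ , ↭-trans r q

zeroSum⇒subsetSum : ∀ {b L} → ZeroSum b L → ∃ λ s → SubsetSum L s × b ∣ s
zeroSum⇒subsetSum (S , T , S≢[] , p , b∣) with ⊆-resp-↭ p (Sub.++⁺ʳ T (⊆-refl {x = S}))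
... | W , W⊆L , W↭S = sum W , (W , W⊆L , nonempty , refl) , subst (_ ∣_) (sym (sum-↭ W↭S)) b∣
  where
  nonempty : W ≢ []
  nonempty refl = S≢[] (Perm.↭-empty-inv (↭-sym W↭S))

-- Congruent pairs and the larger-sieve product

%-≡⇒∣ : ∀ b .{{_ : NonZero b}} x y → x % b ≡ y % b → b ∣ ∣ x - y ∣
%-≡⇒∣ b x y eq = subst (b ∣_) (sym distance) (n∣m*n ∣ x / b - y / b ∣)
  where
  open ≡-Reasoning
  distance : ∣ x - y ∣ ≡ ∣ x / b - y / b ∣ * b
  distance = begin
    ∣ x - y ∣                                       ≡⟨ cong₂ ∣_-_∣ (m≡m%n+[m/n]*n x b) (m≡m%n+[m/n]*n y b) ⟩
    ∣ x % b + x / b * b - y % b + y / b * b ∣       ≡⟨ cong (λ r → ∣ r + x / b * b - y % b + y / b * b ∣) eq ⟩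
    ∣ y % b + x / b * b - y % b + y / b * b ∣       ≡⟨ ∣m+n-m+o∣≡∣n-o∣ (y % b) _ _ ⟩
    ∣ x / b * b - y / b * b ∣                       ≡⟨ *-distribʳ-∣-∣ b (x / b) (y / b) ⟨
    ∣ x / b - y / b ∣ * b                           ∎

sum-map-mono : ∀ {f g : ℕ → ℕ} L → (∀ a → f a ≤ g a) → sum (map f L) ≤ sum (map g L)
sum-map-mono []      f≤g = z≤n
sum-map-mono (a ∷ L) f≤g = +-mono-≤ (f≤g a) (sum-map-mono L f≤g)

sum-map-+ : ∀ (f g : ℕ → ℕ) L → sum (map (λ a → f a + g a) L) ≡ sum (map f L) + sum (map g L)
sum-map-+ f g []      = refl
sum-map-+ f g (a ∷ L) = trans (cong (f a + g a +_) (sum-map-+ f g L))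
  (interchange (f a) (g a) _ _)
  where
  interchange : ∀ a b c d → a + b + (c + d) ≡ a + c + (b + d)
  interchange = solve-∀

occurrences-∉ : ∀ a {L} → All (a ≢_) L → sum (map (λ c → ι (does (a ≟ c))) L) ≡ 0
occurrences-∉ a []              = refl
occurrences-∉ a (_∷_ {c} ne nes) rewrite dec-false (a ≟ c) ne = occurrences-∉ a nes

occurrences-≤1 : ∀ a {L} → Unique L → sum (map (λ c → ι (does (a ≟ c))) L) ≤ 1
occurrences-≤1 a []               = z≤n
occurrences-≤1 a (_∷_ {c} c∉ uniq) with a ≟ c
... | yes refl rewrite dec-true (a ≟ a) refl = ≤-reflexive (cong suc (occurrences-∉ a c∉))
... | no a≢c   rewrite dec-false (a ≟ c) a≢c = occurrences-≤1 a uniq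

congruent : ℕ → ℕ → ℕ → ℕ
congruent b a c = ι (not (does (a ≟ c)) ∧ does (b ∣? ∣ a - c ∣))

congruent-count : ℕ → List ℕ → ℕ → ℕ
congruent-count b A a = sum (map (congruent b a) A)

congruent-pairs : ℕ → List ℕ → ℕ
congruent-pairs b A = sum (map (congruent-count b A) A)

-- Every c in the class of a is either congruent to and distinct from a, or equal to a; the latter
-- happens at most once as `A` has no duplicates.
mult-≤-congruent : ∀ b .{{_ : NonZero b}} {A} → Unique A → ∀ a →
  mult b A (a % b) ≤ suc (congruent-count b A a)
mult-≤-congruent b {A} uniq a = begin
  mult b A (a % b)                                             ≤⟨ sum-map-mono A pointwise ⟩
  sum (map (λ c → congruent b a c + ι (does (a ≟ c))) A)       ≡⟨ sum-map-+ _ _ A ⟩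
  congruent-count b A a + sum (map (λ c → ι (does (a ≟ c))) A) ≤⟨ +-monoʳ-≤ _ (occurrences-≤1 a uniq) ⟩
  congruent-count b A a + 1                                    ≡⟨ +-comm _ 1 ⟩
  suc (congruent-count b A a)                                  ∎
  where
  open ≤-Reasoning
  ι≤1 : ∀ p → ι p ≤ 1
  ι≤1 true  = ≤-refl
  ι≤1 false = z≤n
  pointwise : ∀ c → ι (does (c % b ≟ a % b)) ≤ congruent b a c + ι (does (a ≟ c))
  pointwise c with c % b ≟ a % b
  ... | no ¬eq rewrite dec-false (c % b ≟ a % b) ¬eq = z≤n
  ... | yes eq with a ≟ c
  ...   | yes a≡c rewrite dec-true (a ≟ c) a≡c = ι≤1 _
  ...   | no  a≢c rewrite dec-false (a ≟ c) a≢c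
                        | dec-true (b ∣? ∣ a - c ∣) (%-≡⇒∣ b a c (sym eq)) = ι≤1 _

mult-filter : ∀ b .{{_ : NonZero b}} {P : ℕ → Set} (P? : ∀ a → Dec (P a)) L z →
  mult b (filter P? L) z ≤ mult b L z
mult-filter b P? []      z = z≤n
mult-filter b P? (a ∷ L) z with does (P? a)
... | true  = +-monoʳ-≤ _ (mult-filter b P? L z)
... | false = ≤-trans (mult-filter b P? L z) (m≤n+m _ _)

-- Used to extend a bound on the classes of members of `L` to all z.
mult-witness : ∀ b .{{_ : NonZero b}} L z → mult b L z ≡ 0 ⊎ (∃ λ a → a ∈ L × a % b ≡ z)
mult-witness b []      z = inj₁ refl
mult-witness b (a ∷ L) z with a % b ≟ z
... | yes eq = inj₂ (a , here refl , eq)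
... | no ¬eq rewrite dec-false (a % b ≟ z) ¬eq with mult-witness b L z
...   | inj₁ none          = inj₁ none
...   | inj₂ (c , c∈ , eq) = inj₂ (c , there c∈ , eq)

sum-≥-filter : ∀ {P : ℕ → Set} (P? : ∀ a → Dec (P a)) (f : ℕ → ℕ) h L →
  (∀ a → ¬ P a → h ≤ f a) → h * length L ≤ sum (map f L) + h * length (filter P? L)
sum-≥-filter P? f h []      large = ≤-refl
sum-≥-filter P? f h (a ∷ L) large with P? a
... | yes _ = begin
  h * suc (length L)                        ≡⟨ *-suc h _ ⟩
  h + h * length L                          ≤⟨ +-monoʳ-≤ h (sum-≥-filter P? f h L large) ⟩
  h + (sum (map f L) + h * T)               ≤⟨ m≤n+m _ (f a) ⟩
  f a + (h + (sum (map f L) + h * T))       ≡⟨ rearrange (f a) h (sum (map f L)) T ⟩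
  f a + sum (map f L) + h * suc T           ∎
  where
  open ≤-Reasoning
  T : ℕ
  T = length (filter P? L)
  rearrange : ∀ x h s T → x + (h + (s + h * T)) ≡ x + s + h * suc T
  rearrange = solve-∀
... | no ¬Pa = begin
  h * suc (length L)                        ≡⟨ *-suc h _ ⟩
  h + h * length L                          ≤⟨ +-mono-≤ (large a ¬Pa) (sum-≥-filter P? f h L large) ⟩
  f a + (sum (map f L) + h * T)             ≡⟨ +-assoc (f a) _ _ ⟨
  f a + sum (map f L) + h * T               ∎
  where
  open ≤-Reasoning
  T : ℕ
  T = length (filter P? L)

square-cancel-≤ : ∀ {m n} → m * m ≤ n * n → m ≤ n
square-cancel-≤ le = ≮⇒≥ λ n<m → <⇒≱ (*-mono-< n<m n<m) le

-- `ZeroSumBound` for all moduli, with the constant 64 · 24 abstracted to `K`.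
MultBound : ℕ → Set
MultBound K = ∀ b .{{_ : NonZero b}} h L → 1 ≤ h → (∀ z → mult b L z ≤ h) →
  K * (h * b) < length L * length L → ZeroSum b L

-- The elements in classes of at most `h` members form a zero-sum-free list `T`, so |T|² ≤ K h b,
-- and the choice of `h` makes this at most n² / 4. Each of the other elements, at least half of
-- `A`, is congruent to at least `h` others, whence h n ≤ 2 E.
many-congruent-pairs : ∀ K .{{_ : NonZero K}} → MultBound K → ∀ b .{{_ : NonZero b}} A → Unique A →
  4 * K * b ≤ length A * length A → (∀ {s} → SubsetSum A s → ¬ (b ∣ s)) →
  length A * (length A * length A) ≤ 16 * K * (b * congruent-pairs b A)
many-congruent-pairs K bound b A uniq b-small free = begin
  n * (n * n)                     ≤⟨ *-monoʳ-≤ n n²≤ ⟩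
  n * (2 * (h * D))               ≡⟨ eq₁ n h D ⟩
  2 * D * (h * n)                 ≤⟨ *-monoʳ-≤ (2 * D) hn≤2E ⟩
  2 * D * (2 * E)                 ≡⟨ eq₂ K b E ⟩
  16 * K * (b * E)                ∎
  where
  open ≤-Reasoning
  n D E : ℕ
  n = length A
  D = 4 * K * b
  E = congruent-pairs b A
  instance
    4K≢0 : NonZero (4 * K)
    4K≢0 = m*n≢0 4 K
    D≢0 : NonZero D
    D≢0 = m*n≢0 (4 * K) b
  -- The largest `h` with 4 K h b ≤ n². The smallness of b makes it positive, so rounding down costs
  -- at most a factor 2.
  h : ℕ
  h = n * n / D
  1≤h : 1 ≤ h
  1≤h = m≥n⇒m/n>0 b-small
  hD≤n² : h * D ≤ n * n
  hD≤n² = m/n*n≤m (n * n) D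
  n²≤ : n * n ≤ 2 * (h * D)
  n²≤ = begin
    n * n               ≡⟨ m≡m%n+[m/n]*n (n * n) D ⟩
    n * n % D + h * D   ≤⟨ +-monoˡ-≤ (h * D) (≤-trans (<⇒≤ (m%n<n (n * n) D)) (m≤n*m D h {{>-nonZero 1≤h}})) ⟩
    h * D + h * D       ≡⟨ cong (h * D +_) (+-identityʳ (h * D)) ⟨
    2 * (h * D)         ∎

  rare? : ∀ a → Dec (mult b A (a % b) ≤ h)
  rare? a = mult b A (a % b) ≤? h
  T : List ℕ
  T = filter rare? A
  mult-T : ∀ z → mult b T z ≤ h
  mult-T z with mult-witness b T z
  ... | inj₁ none = ≤-trans (≤-reflexive none) z≤n
  ... | inj₂ (a , a∈T , refl) =
    ≤-trans (mult-filter b rare? A (a % b)) (proj₂ (∈-filter⁻ rare? {xs = A} a∈T))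
  T-short : length T * length T ≤ K * (h * b)
  T-short = ≮⇒≥ λ lt → let s , (S , S⊆T , rest) , b∣s = zeroSum⇒subsetSum (bound b h T 1≤h mult-T lt)
                       in free (S , ⊆-trans S⊆T (Sub.filter-⊆ rare? A) , rest) b∣s
  2T≤n : 2 * length T ≤ n
  2T≤n = square-cancel-≤ (begin
    2 * length T * (2 * length T) ≡⟨ eq₃ (length T) ⟩
    4 * (length T * length T)     ≤⟨ *-monoʳ-≤ 4 T-short ⟩
    4 * (K * (h * b))             ≡⟨ eq₄ K h b ⟩
    h * D                         ≤⟨ hD≤n² ⟩
    n * n                         ∎)
    where
    eq₃ : ∀ t → 2 * t * (2 * t) ≡ 4 * (t * t)
    eq₃ = solve-∀
    eq₄ : ∀ K h b → 4 * (K * (h * b)) ≡ h * (4 * K * b)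
    eq₄ = solve-∀
  hn≤2E : h * n ≤ 2 * E
  hn≤2E = +-cancelʳ-≤ (h * n) _ _ (begin
    h * n + h * n               ≡⟨ cong (h * n +_) (+-identityʳ (h * n)) ⟨
    2 * (h * n)                 ≤⟨ *-monoʳ-≤ 2 (sum-≥-filter rare? (congruent-count b A) h A
                                     (λ a frequent → s≤s⁻¹ (≤-trans (≰⇒> frequent) (mult-≤-congruent b uniq a)))) ⟩
    2 * (E + h * length T)      ≡⟨ eq₅ E h (length T) ⟩
    2 * E + h * (2 * length T)  ≤⟨ +-monoʳ-≤ (2 * E) (*-monoʳ-≤ h 2T≤n) ⟩
    2 * E + h * n               ∎)
    where
    eq₅ : ∀ E h t → 2 * (E + h * t) ≡ 2 * E + h * (2 * t)
    eq₅ = solve-∀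
  eq₁ : ∀ n h D → n * (2 * (h * D)) ≡ 2 * D * (h * n)
  eq₁ = solve-∀
  eq₂ : ∀ K b E → 2 * (4 * K * b) * (2 * E) ≡ 16 * K * (b * E)
  eq₂ = solve-∀

-- Products of powers of pairwise coprime moduli

∏^ : (ℕ → ℕ) → List ℕ → ℕ
∏^ e []      = 1
∏^ e (b ∷ B) = b ^ e b * ∏^ e B

∏^-0 : ∀ B → ∏^ (λ _ → 0) B ≡ 1
∏^-0 []      = refl
∏^-0 (b ∷ B) = trans (+-identityʳ _) (∏^-0 B)

∏^-+ : ∀ e f B → ∏^ (λ b → e b + f b) B ≡ ∏^ e B * ∏^ f B
∏^-+ e f []      = refl
∏^-+ e f (b ∷ B) = trans (cong₂ _*_ (^-distribˡ-+-* b (e b) (f b)) (∏^-+ e f B))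
  (interchange (b ^ e b) (b ^ f b) _ _)
  where
  interchange : ∀ a b c d → a * b * (c * d) ≡ a * c * (b * d)
  interchange = solve-∀

-- Sums in the exponents turn into products over `L`. It is applied twice, once for each member of a
-- pair.
∏^-sum-≤ : ∀ (e : ℕ → ℕ → ℕ) B {M} L → (∀ {a} → a ∈ L → ∏^ (λ b → e b a) B ≤ M) →
  ∏^ (λ b → sum (map (e b) L)) B ≤ M ^ length L
∏^-sum-≤ e B []      ≤M = ≤-reflexive (∏^-0 B)
∏^-sum-≤ e B (a ∷ L) ≤M = ≤-trans (≤-reflexive (∏^-+ (λ b → e b a) _ B))
  (*-mono-≤ (≤M (here refl)) (∏^-sum-≤ e B L (≤M ∘ there)))

coprime-* : ∀ {m x y} → Coprime m x → Coprime m y → Coprime m (x * y)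
coprime-* mx my (d∣m , d∣xy) =
  my (d∣m , coprime-divisor (λ (c∣d , c∣x) → mx (∣-trans c∣d d∣m , c∣x)) d∣xy)

coprime-∣-* : ∀ {m x y} → Coprime x y → x ∣ m → y ∣ m → x * y ∣ m
coprime-∣-* {x = x} {y} xy x∣m (divides q refl) =
  *-monoˡ-∣ y (coprime-divisor xy (subst (x ∣_) (*-comm q y) x∣m))

coprime-∏^ : ∀ {m} (χ : ℕ → Bool) {B} → All (Coprime m) B → Coprime m (∏^ (ι ∘ χ) B)
coprime-∏^ χ []                   (_ , d∣1) = ∣1⇒≡1 d∣1
coprime-∏^ {m} χ (_∷_ {b} mb mB) = coprime-* factor (coprime-∏^ χ mB)
  where
  factor : Coprime m (b ^ ι (χ b))
  factor with χ b
  ... | true  = subst (Coprime m) (sym (*-identityʳ b)) mb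
  ... | false = λ (_ , d∣1) → ∣1⇒≡1 d∣1

-- Each b dividing m is coprime to the product of the later divisors, so their product still divides
-- m.
∏^-divisors-∣ : ∀ m {B} → AllPairs Coprime B → ∏^ (λ b → ι (does (b ∣? m))) B ∣ m
∏^-divisors-∣ m []                 = 1∣ m
∏^-divisors-∣ m (_∷_ {b} {B} bB pw) with b ∣? m
... | yes b∣m rewrite *-identityʳ b =
  coprime-∣-* (coprime-∏^ (λ c → does (c ∣? m)) bB) b∣m (∏^-divisors-∣ m pw)
... | no b∤m rewrite +-identityʳ (∏^ (λ c → ι (does (c ∣? m))) B) =
  ∏^-divisors-∣ m pw

-- For a ≠ c the product divides the nonzero number |a - c| ≤ N; for a = c all exponents vanish.
∏^-congruent-≤ : ∀ {N a c B} → 1 ≤ N → a ≤ N → c ≤ N → AllPairs Coprime B →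
  ∏^ (λ b → congruent b a c) B ≤ N
∏^-congruent-≤ {N} {a} {c} {B} 1≤N a≤N c≤N pw with a ≟ c
... | yes refl rewrite dec-true (a ≟ a) refl = ≤-trans (≤-reflexive (∏^-0 B)) 1≤N
... | no a≢c rewrite dec-false (a ≟ c) a≢c = ≤-trans
  (∣⇒≤ {{≢-nonZero (a≢c ∘ ∣m-n∣≡0⇒m≡n)}} (∏^-divisors-∣ ∣ a - c ∣ pw))
  (≤-trans (∣m-n∣≤m⊔n a c) (⊔-lub a≤N c≤N))

-- The helper function of weightPow has no accessible name. Its arguments being abstracted to
-- distinct variables by the with, unification recovers it as the value of weightGo.
mutual
  weightGo : ℕ → List ℕ → ℕ → List ℕ → ℕ
  weightGo = _

  weightPow-∷ : ∀ k b l → weightPow k (b ∷ l) ≡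
    b ^ (k * (1 * product l)) * weightGo k (b ∷ l) (1 * b) l
  weightPow-∷ k b l with 1 * b | b ∷ l
  ... | w | c = refl

-- From pair counts to the weight

^-distribʳ-* : ∀ k x y → (x * y) ^ k ≡ x ^ k * y ^ k
^-distribʳ-* zero    x y = refl
^-distribʳ-* (suc k) x y = trans (cong (x * y *_) (^-distribʳ-* k x y))
  (interchange x y (x ^ k) (y ^ k))
  where
  interchange : ∀ a b c d → a * b * (c * d) ≡ a * c * (b * d)
  interchange = solve-∀

-- Let P be `pre` times the product of the list, which stays constant along the recursion. In
-- logarithms, b contributes n³ (P / b) log b on the left and C P (e b) log b on the right; the
-- hypothesis at b, multiplied by P / b, compares the two.
weightGo-≤ : ∀ n C (e : ℕ → ℕ) bs pre l → (∀ {b} → b ∈ l → 1 ≤ b × n * (n * n) ≤ C * (b * e b)) →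
  weightGo n bs pre l ^ (n * n) ≤ ∏^ e l ^ (C * (pre * product l))
weightGo-≤ n C e bs pre []      hyp =
  ≤-reflexive (trans (^-zeroˡ (n * n)) (sym (^-zeroˡ (C * (pre * 1)))))
weightGo-≤ n C e bs pre (b ∷ l) hyp = begin
  (b ^ (n * r) * g) ^ (n * n)             ≡⟨ ^-distribʳ-* (n * n) (b ^ (n * r)) g ⟩
  (b ^ (n * r)) ^ (n * n) * g ^ (n * n)   ≤⟨ *-mono-≤ head tail ⟩
  (b ^ e b) ^ x * ∏^ e l ^ x              ≡⟨ ^-distribʳ-* x (b ^ e b) (∏^ e l) ⟨
  ∏^ e (b ∷ l) ^ x                        ∎
  where
  open ≤-Reasoning
  r g x : ℕ
  r = pre * product l
  g = weightGo n bs (pre * b) l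
  x = C * (pre * product (b ∷ l))
  head : (b ^ (n * r)) ^ (n * n) ≤ (b ^ e b) ^ x
  head = begin
    (b ^ (n * r)) ^ (n * n)  ≡⟨ ^-*-assoc b (n * r) (n * n) ⟩
    b ^ (n * r * (n * n))    ≤⟨ ^-monoʳ-≤ b {{>-nonZero (proj₁ (hyp (here refl)))}} exponents ⟩
    b ^ (e b * x)            ≡⟨ ^-*-assoc b (e b) x ⟨
    (b ^ e b) ^ x            ∎
    where
    eq₁ : ∀ n r → n * r * (n * n) ≡ n * (n * n) * r
    eq₁ = solve-∀
    eq₂ : ∀ C b e p l → C * (b * e) * (p * l) ≡ e * (C * (p * (b * l)))
    eq₂ = solve-∀
    exponents : n * r * (n * n) ≤ e b * x
    exponents = begin
      n * r * (n * n)       ≡⟨ eq₁ n r ⟩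
      n * (n * n) * r       ≤⟨ *-monoˡ-≤ r (proj₂ (hyp (here refl))) ⟩
      C * (b * e b) * r     ≡⟨ eq₂ C b (e b) pre (product l) ⟩
      e b * x               ∎
  tail : g ^ (n * n) ≤ ∏^ e l ^ x
  tail = ≤-trans (weightGo-≤ n C e bs (pre * b) l (hyp ∘ there))
    (≤-reflexive (cong (λ t → ∏^ e l ^ (C * t)) (*-assoc pre b (product l))))

^-cancelʳ-≤ : ∀ k .{{_ : NonZero k}} {m n} → m ^ k ≤ n ^ k → m ≤ n
^-cancelʳ-≤ k le = ≮⇒≥ λ n<m → <⇒≱ (^-monoˡ-< k n<m) le

weight-bound : ∀ K .{{_ : NonZero K}} → MultBound K →
  (N : ℕ) → 1 ≤ N → (A : List ℕ) → Unique A →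
  (∀ {a} → a ∈ A → 1 ≤ a × a ≤ N) →
  (B : List ℕ) → (∀ {b} → b ∈ B → 1 ≤ b × 4 * K * b ≤ 1 * (length A * length A)) →
  AllPairs Coprime B →
  (∀ {b s} → b ∈ B → SubsetSum A s → ¬ (b ∣ s)) →
  weightPow (length A) B ≤ N ^ (16 * K * product B)
-- For empty `B` the list `A` may be empty too, and no n²-th root could be taken. A member of `B`
-- forces n ≥ 1.
weight-bound K bound N 1≤N A uniq A-range []      B-range pw free = m^n>0 N {{>-nonZero 1≤N}} (16 * K * 1)
weight-bound K bound N 1≤N A uniq A-range B@(b₀ ∷ _) B-range pw free =
  ^-cancelʳ-≤ (n * n) {{>-nonZero 1≤n²}} (begin
    weightPow n B ^ (n * n)       ≤⟨ weightGo-≤ n C E B 1 B hyp ⟩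
    ∏^ E B ^ (C * (1 * P))        ≤⟨ ^-monoˡ-≤ (C * (1 * P)) ∏≤ ⟩
    ((N ^ n) ^ n) ^ (C * (1 * P)) ≡⟨ cong₂ _^_ (^-*-assoc N n n) (cong (C *_) (*-identityˡ P)) ⟩
    (N ^ (n * n)) ^ (C * P)       ≡⟨ ^-*-assoc N (n * n) (C * P) ⟩
    N ^ (n * n * (C * P))         ≡⟨ cong (N ^_) (*-comm (n * n) (C * P)) ⟩
    N ^ (C * P * (n * n))         ≡⟨ ^-*-assoc N (C * P) (n * n) ⟨
    (N ^ (C * P)) ^ (n * n)       ∎)
  where
  open ≤-Reasoning
  n C P : ℕ
  n = length A
  C = 16 * K
  P = product B
  E : ℕ → ℕ
  E b = congruent-pairs b A
  B-small : ∀ {b} → b ∈ B → 4 * K * b ≤ n * n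
  B-small b∈B = ≤-trans (proj₂ (B-range b∈B)) (≤-reflexive (*-identityˡ (n * n)))
  1≤n² : 1 ≤ n * n
  1≤n² = ≤-trans (*-mono-≤ (>-nonZero⁻¹ (4 * K) {{m*n≢0 4 K}}) (proj₁ (B-range (here refl))))
    (B-small (here refl))
  hyp : ∀ {b} → b ∈ B → 1 ≤ b × n * (n * n) ≤ C * (b * E b)
  hyp {b} b∈B = proj₁ (B-range b∈B) ,
    many-congruent-pairs K bound b {{>-nonZero (proj₁ (B-range b∈B))}} A uniq (B-small b∈B) (free b∈B)
  ∏≤ : ∏^ E B ≤ (N ^ n) ^ n
  ∏≤ = ∏^-sum-≤ (λ b → congruent-count b A) B A (λ {a} a∈A →
    ∏^-sum-≤ (λ b → congruent b a) B A (λ {c} c∈A →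
      ∏^-congruent-≤ 1≤N (proj₂ (A-range a∈A)) (proj₂ (A-range c∈A)) pw))

-- Here c = `p / q`, and taking logarithms and dividing by `product B` turns the conclusion into the
-- stated inequality. With K = 64 · 24, the constants are c = 1 / (4K) and C = 16K.
theorem1p4 : ∃ λ (p : ℕ) → ∃ λ (q : ℕ) → ∃ λ (C : ℕ) → (0 < p) × (0 < q) ×
    ((N : ℕ) → 1 ≤ N → (A : List ℕ) → Unique A →
    (∀ {a} → a ∈ A → 1 ≤ a × a ≤ N) →
    (B : List ℕ) → Unique B →
    (∀ {b} → b ∈ B → 1 ≤ b × q * b ≤ p * (length A * length A)) →
    AllPairs Coprime B →
    (∀ {b s} → b ∈ B → SubsetSum A s → ¬ (b ∣ s)) →
    weightPow (length A) B ≤ N ^ (C * product B))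
theorem1p4 = 1 , 4 * (64 * 24) , 16 * (64 * 24) , s≤s z≤n , s≤s z≤n ,
  λ N 1≤N A A-unique A-range B _ → weight-bound (64 * 24) bound N 1≤N A A-unique A-range B
  where
  bound : MultBound (64 * 24)
  bound b h L 1≤h mult≤h long =
    zeroSum-bound b h L 1≤h mult≤h (subst (_< length L * length L) (*-assoc 64 24 (h * b)) long)
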